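{- Let $n, b, j$ be positive integers with $b \geq 2$ such that $n$ divides $b^j - 1$. Then $n$ is flimsy in base $b$ if and only if $s_b(kn) < s_b(n)$ for some integer $k$ satisfying $1 \leq k \leq \frac{b^j-1}{n}$.
   Context: For an integer $b\ge 2$ and a non-negative integer $m$, $s_b(m)$ denotes the sum of the digits of $m$ when written in base $b$. A positive integer $n$ is flimsy in base $b$ if there exists a positive integer $k$ with $s_b(kn) < s_b(n)$; otherwise $n$ is sturdy in base $b$. -}

module Defs where

open import Data.Digit using (toDigits)
open import Data.Fin.Base using (toℕ)
open import Data.List.Base using (map)
open import Data.Nat.Base using (ℕ; _*_; _≤_; _<_; NonTrivial; nonTrivial⇒n>1)
open import Data.Nat.ListAction using (sum)
open import Data.Product.Base using (∃-syntax; _×_; proj₁)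
open import Relation.Nullary.Decidable.Core using (fromWitness)
open import Relation.Nullary.Negation.Core using (¬_)

-- NonTrivial b says that b ≥ 2.
s : (b : ℕ) → .{{_ : NonTrivial b}} → ℕ → ℕ
s b m = sum (map toℕ (proj₁ (toDigits b {fromWitness (nonTrivial⇒n>1 b)} m)))

-- The notions are only meant for positive n; Flimsy b 0 does not hold.
Flimsy : (b : ℕ) → .{{_ : NonTrivial b}} → ℕ → Set
Flimsy b n = ∃[ k ] 1 ≤ k × s b (k * n) < s b n

Sturdy : (b : ℕ) → .{{_ : NonTrivial b}} → ℕ → Set
Sturdy b n = ¬ Flimsy b n

{-# OPTIONS --safe #-}
-- Write a multiple m ≥ b ^ j of n as r + q * b ^ j with r < b ^ j.  Since
-- b ^ j ≡ 1 modulo n, the smaller positive number r + q is again a multiple of n,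
-- and s (r + q) ≤ s r + s q = s m.  Iterating leads to a multiple below b ^ j.
module Submission where

open import Defs
open import Data.Nat.Base using (ℕ; _*_; _∸_; _^_; _/_; _≤_; _<_; NonZero; NonTrivial)
open import Data.Nat.Divisibility using (_∣_)
open import Data.Product.Base using (∃-syntax; _×_)
open import Function.Bundles using (_⇔_)

open import Data.Digit using (Expansion; fromDigits; toDigits)
open import Data.Fin.Base using (toℕ; fromℕ<)
open import Data.Fin.Properties using (toℕ<n; toℕ-fromℕ<)
open import Data.List.Base using (map; []; _∷_)
open import Data.Nat.Base
  using (zero; suc; _+_; _%_; z≤n; s≤s; z<s; nonTrivial⇒nonZero; nonTrivial⇒n>1; >-nonZero⁻¹)
open import Data.Nat.Divisibility using (divides; ∣m+n∣m⇒∣n; ∣n⇒∣m*n)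
open import Data.Nat.DivMod
  using (m≡m%n+[m/n]*n; m%n<n; m<n⇒m%n≡m; [m+kn]%n≡m%n; m<n*o⇒m/o<n; m≥n⇒m/n>0; m*n/n≡m; /-monoˡ-≤)
open import Data.Nat.Induction using (Acc; acc; <-wellFounded)
open import Data.Nat.ListAction using (sum)
open import Data.Nat.Properties
open import Data.Nat.Tactic.RingSolver using (solve-∀)
open import Data.Product.Base using (_,_; proj₁; proj₂)
open import Data.Sum.Base using (inj₁; inj₂)
open import Function.Bundles using (mk⇔)
open import Relation.Binary.PropositionalEquality
  using (_≡_; refl; sym; trans; cong; cong₂; subst; module ≡-Reasoning)
open import Relation.Nullary.Decidable.Core using (yes; no; fromWitness)

module _ (b : ℕ) .{{_ : NonTrivial b}} where

  private instance
    b≢0 : NonZero b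
    b≢0 = nonTrivial⇒nonZero b

  digitSum : Expansion b → ℕ
  digitSum ds = sum (map toℕ ds)

  digits : ∀ n → ∃[ ds ] fromDigits {b} ds ≡ n
  digits = toDigits b {fromWitness (nonTrivial⇒n>1 b)}

  -- `toDigits` returns a digit list together with a proof of its value, so a claim about numbers
  -- reduces to one about digit lists, which admits structural induction.
  digits-elim : (P : ℕ → Set) → (∀ ds → P (fromDigits ds)) → ∀ n → P n
  digits-elim P p n = subst P (proj₂ (digits n)) (p (proj₁ (digits n)))

  remainder-unique : ∀ {r r′} q q′ → r < b → r′ < b → r + q * b ≡ r′ + q′ * b → r ≡ r′
  remainder-unique {r} {r′} q q′ r<b r′<b eq = begin
    r                 ≡⟨ m<n⇒m%n≡m r<b ⟨
    r % b             ≡⟨ [m+kn]%n≡m%n r q b ⟨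
    (r + q * b) % b   ≡⟨ cong (_% b) eq ⟩
    (r′ + q′ * b) % b ≡⟨ [m+kn]%n≡m%n r′ q′ b ⟩
    r′ % b            ≡⟨ m<n⇒m%n≡m r′<b ⟩
    r′                ∎
    where open ≡-Reasoning

  quotient-unique : ∀ {r r′} q q′ → r < b → r′ < b → r + q * b ≡ r′ + q′ * b → q ≡ q′
  quotient-unique {r} q q′ r<b r′<b eq with refl ← remainder-unique q q′ r<b r′<b eq =
    *-cancelʳ-≡ q q′ b (+-cancelˡ-≡ r _ _ eq)

  digitSum-zero : ∀ ds → fromDigits ds ≡ 0 → digitSum ds ≡ 0
  digitSum-zero []       _  = refl
  digitSum-zero (d ∷ ds) eq = cong₂ _+_ (m+n≡0⇒m≡0 (toℕ d) eq)
    (digitSum-zero ds (m*n≡0⇒m≡0 (fromDigits ds) b (m+n≡0⇒n≡0 (toℕ d) eq)))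

  -- Expansions of the same number may still differ in their leading zeros.
  digitSum-unique : ∀ ds es → fromDigits ds ≡ fromDigits es → digitSum ds ≡ digitSum es
  digitSum-unique []       es       eq = sym (digitSum-zero es (sym eq))
  digitSum-unique (d ∷ ds) []       eq = digitSum-zero (d ∷ ds) eq
  digitSum-unique (d ∷ ds) (e ∷ es) eq = cong₂ _+_
    (remainder-unique (fromDigits ds) (fromDigits es) (toℕ<n d) (toℕ<n e) eq)
    (digitSum-unique ds es
      (quotient-unique (fromDigits ds) (fromDigits es) (toℕ<n d) (toℕ<n e) eq))

  -- By uniqueness up to leading zeros, `s` may be computed from any expansion, so the particular
  -- list chosen by `toDigits` stops mattering.
  s-fromDigits : ∀ ds → s b (fromDigits ds) ≡ digitSum ds
  s-fromDigits ds = digitSum-unique (proj₁ (digits (fromDigits ds))) ds (proj₂ (digits (fromDigits ds)))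

  s-cons : ∀ {r} q → r < b → s b (r + q * b) ≡ r + s b q
  s-cons {r} q r<b = digits-elim (λ q → s b (r + q * b) ≡ r + s b q) (λ ds → begin
    s b (r + fromDigits ds * b)       ≡⟨ cong (λ x → s b (x + fromDigits ds * b)) (toℕ-fromℕ< r<b) ⟨
    s b (fromDigits (fromℕ< r<b ∷ ds)) ≡⟨ s-fromDigits (fromℕ< r<b ∷ ds) ⟩
    toℕ (fromℕ< r<b) + digitSum ds    ≡⟨ cong₂ _+_ (toℕ-fromℕ< r<b) (sym (s-fromDigits ds)) ⟩
    r + s b (fromDigits ds)           ∎) q
    where open ≡-Reasoning

  s-divMod : ∀ n → s b n ≡ n % b + s b (n / b)
  s-divMod n = trans (cong (s b) (m≡m%n+[m/n]*n n b)) (s-cons (n / b) (m%n<n n b))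

  s-suc-fromDigits : ∀ ds → s b (suc (fromDigits ds)) ≤ suc (digitSum ds)
  s-suc-fromDigits []       = ≤-reflexive (trans (s-cons 0 (nonTrivial⇒n>1 b)) (cong suc (s-fromDigits [])))
  s-suc-fromDigits (d ∷ ds) with m≤n⇒m<n∨m≡n (toℕ<n d)
  ... | inj₁ 1+d<b = ≤-reflexive (trans (s-cons (fromDigits ds) 1+d<b)
                       (cong (suc (toℕ d) +_) (s-fromDigits ds)))
  -- A carry: the last digit `b ∸ 1` becomes 0 and the increment passes to the higher digits. The
  -- dropped digit only lowers the sum.
  ... | inj₂ 1+d≡b = begin
    s b (suc (toℕ d) + fromDigits ds * b) ≡⟨ cong (λ x → s b (x + fromDigits ds * b)) 1+d≡b ⟩
    s b (suc (fromDigits ds) * b)         ≡⟨ s-cons (suc (fromDigits ds)) (>-nonZero⁻¹ b) ⟩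
    s b (suc (fromDigits ds))             ≤⟨ s-suc-fromDigits ds ⟩
    suc (digitSum ds)                     ≤⟨ s≤s (m≤n+m (digitSum ds) (toℕ d)) ⟩
    suc (toℕ d + digitSum ds)             ∎
    where open ≤-Reasoning

  s-suc : ∀ n → s b (suc n) ≤ suc (s b n)
  s-suc = digits-elim (λ n → s b (suc n) ≤ suc (s b n)) λ ds →
    ≤-trans (s-suc-fromDigits ds) (≤-reflexive (cong suc (sym (s-fromDigits ds))))

  -- Here `a` need not be a digit: the units are added one at a time, each raising the digit sum by
  -- at most 1. This absorbs the carry when two last digits are added.
  s-cons-≤ : ∀ a q → s b (a + q * b) ≤ a + s b q
  s-cons-≤ zero    q = ≤-reflexive (s-cons q (>-nonZero⁻¹ b))
  s-cons-≤ (suc a) q = ≤-trans (s-suc (a + q * b)) (s≤s (s-cons-≤ a q))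

  -- Schoolbook addition: the last digits are added without normalising, then the induction
  -- hypothesis treats the higher digits, with `n` replaced by `n / b`.
  s-fromDigits-+ : ∀ ds n → s b (fromDigits ds + n) ≤ digitSum ds + s b n
  s-fromDigits-+ []       n = ≤-refl
  s-fromDigits-+ (d ∷ ds) n = begin
    s b (toℕ d + q * b + n)                   ≡⟨ cong (λ x → s b (toℕ d + q * b + x)) (m≡m%n+[m/n]*n n b) ⟩
    s b (toℕ d + q * b + (n % b + n / b * b)) ≡⟨ cong (s b) (regroup (toℕ d) q (n % b) (n / b) b) ⟩
    s b (toℕ d + n % b + (q + n / b) * b)     ≤⟨ s-cons-≤ (toℕ d + n % b) (q + n / b) ⟩
    toℕ d + n % b + s b (q + n / b)           ≤⟨ +-monoʳ-≤ (toℕ d + n % b) (s-fromDigits-+ ds (n / b)) ⟩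
    toℕ d + n % b + (digitSum ds + s b (n / b)) ≡⟨ interchange (toℕ d) (n % b) (digitSum ds) (s b (n / b)) ⟩
    toℕ d + digitSum ds + (n % b + s b (n / b)) ≡⟨ cong (toℕ d + digitSum ds +_) (s-divMod n) ⟨
    toℕ d + digitSum ds + s b n               ∎
    where
    open ≤-Reasoning
    q = fromDigits ds
    regroup : ∀ d q r p b → d + q * b + (r + p * b) ≡ d + r + (q + p) * b
    regroup = solve-∀
    interchange : ∀ w x y z → w + x + (y + z) ≡ w + y + (x + z)
    interchange = solve-∀

  s-subadditive : ∀ m n → s b (m + n) ≤ s b m + s b n
  s-subadditive m n = digits-elim (λ m → s b (m + n) ≤ s b m + s b n) (λ ds →
    ≤-trans (s-fromDigits-+ ds n) (≤-reflexive (cong (_+ s b n) (sym (s-fromDigits ds))))) m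

  -- Cutting an expansion at position `j` involves no carries, so equality holds. The induction on
  -- `j` peels off the last digit of `r`.
  s-split : ∀ j {r} q → r < b ^ j → s b (r + q * b ^ j) ≡ s b r + s b q
  -- The bound `r < b ^ 0` forces `r` to be 0.
  s-split zero    q (s≤s z≤n) = begin
    s b (q * 1)       ≡⟨ cong (s b) (*-identityʳ q) ⟩
    s b q             ≡⟨ cong (_+ s b q) (s-fromDigits []) ⟨
    s b 0 + s b q     ∎
    where open ≡-Reasoning
  s-split (suc j) {r} q r<bʲ⁺¹ = begin
    s b (r + q * (b * b ^ j))                     ≡⟨ cong (λ x → s b (x + q * (b * b ^ j))) (m≡m%n+[m/n]*n r b) ⟩
    s b (r % b + r / b * b + q * (b * b ^ j))     ≡⟨ cong (s b) (regroup (r % b) (r / b) q b (b ^ j)) ⟩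
    s b (r % b + (r / b + q * b ^ j) * b)         ≡⟨ s-cons (r / b + q * b ^ j) (m%n<n r b) ⟩
    r % b + s b (r / b + q * b ^ j)               ≡⟨ cong (r % b +_) (s-split j q r/b<bʲ) ⟩
    r % b + (s b (r / b) + s b q)                 ≡⟨ +-assoc (r % b) _ _ ⟨
    r % b + s b (r / b) + s b q                   ≡⟨ cong (_+ s b q) (s-divMod r) ⟨
    s b r + s b q                                 ∎
    where
    open ≡-Reasoning
    regroup : ∀ r p q b c → r + p * b + q * (b * c) ≡ r + (p + q * c) * b
    regroup = solve-∀
    r/b<bʲ : r / b < b ^ j
    r/b<bʲ = m<n*o⇒m/o<n (subst (r <_) (*-comm b (b ^ j)) r<bʲ⁺¹)

  module _ (j : ℕ) .{{_ : NonZero j}} where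

    private
      instance
        bʲ≢0 : NonZero (b ^ j)
        bʲ≢0 = m^n≢0 b j

    -- One step of casting out nines, with `b ^ j ∸ 1` in the role of nine.
    fold : ℕ → ℕ
    fold m = m / b ^ j + m % b ^ j

    fold-positive : ∀ {m} → b ^ j ≤ m → 0 < fold m
    fold-positive bʲ≤m = ≤-trans (m≥n⇒m/n>0 bʲ≤m) (m≤m+n _ _)

    -- What `fold` removes is a multiple of `b ^ j ∸ 1`. This one equation yields both the strict
    -- decrease and the preservation of divisibility by `n`.
    fold-excess : ∀ m → m ≡ m / b ^ j * (b ^ j ∸ 1) + fold m
    fold-excess m = begin
      m                                         ≡⟨ m≡m%n+[m/n]*n m (b ^ j) ⟩
      m % b ^ j + q * b ^ j                     ≡⟨ cong (λ x → m % b ^ j + q * x) (m∸n+n≡m (>-nonZero⁻¹ (b ^ j))) ⟨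
      m % b ^ j + q * (b ^ j ∸ 1 + 1)           ≡⟨ regroup (m % b ^ j) q (b ^ j ∸ 1) ⟩
      q * (b ^ j ∸ 1) + (q + m % b ^ j)         ∎
      where
      open ≡-Reasoning
      q = m / b ^ j
      regroup : ∀ r q c → r + q * (c + 1) ≡ q * c + (q + r)
      regroup = solve-∀

    1<bʲ : 1 < b ^ j
    1<bʲ = ≤-trans (nonTrivial⇒n>1 b)
      (≤-trans (≤-reflexive (sym (*-identityʳ b))) (^-monoʳ-≤ b (>-nonZero⁻¹ j)))

    fold-< : ∀ {m} → b ^ j ≤ m → fold m < m
    fold-< {m} bʲ≤m = subst (fold m <_) (sym (fold-excess m))
      -- Both factors of the excess are at least 1, and `1 * 1 + fold m` computes to `suc (fold m)`.
      (+-monoˡ-≤ (fold m) (*-mono-≤ (m≥n⇒m/n>0 bʲ≤m) (m<n⇒0<n∸m 1<bʲ)))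

    ∣-fold : ∀ {n m} → n ∣ b ^ j ∸ 1 → n ∣ m → n ∣ fold m
    ∣-fold {n} {m} n∣bʲ-1 n∣m =
      ∣m+n∣m⇒∣n (subst (n ∣_) (fold-excess m) n∣m) (∣n⇒∣m*n (m / b ^ j) n∣bʲ-1)

    s-fold : ∀ m → s b (fold m) ≤ s b m
    s-fold m = begin
      s b (m / b ^ j + m % b ^ j)         ≤⟨ s-subadditive (m / b ^ j) (m % b ^ j) ⟩
      s b (m / b ^ j) + s b (m % b ^ j)   ≡⟨ +-comm (s b (m / b ^ j)) _ ⟩
      s b (m % b ^ j) + s b (m / b ^ j)   ≡⟨ s-split j (m / b ^ j) (m%n<n m (b ^ j)) ⟨
      s b (m % b ^ j + m / b ^ j * b ^ j) ≡⟨ cong (s b) (m≡m%n+[m/n]*n m (b ^ j)) ⟨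
      s b m                               ∎
      where open ≤-Reasoning

    -- Descent along `fold`. Positivity is carried through because 0 is a multiple of `n` too, and
    -- it would yield the forbidden multiplier 0.
    small-multiple : ∀ {n} → n ∣ b ^ j ∸ 1 → ∀ {m} → Acc _<_ m → 0 < m → n ∣ m →
      ∃[ m′ ] 0 < m′ × m′ ≤ b ^ j ∸ 1 × n ∣ m′ × s b m′ ≤ s b m
    small-multiple n∣bʲ-1 {m} (acc rec) 0<m n∣m with b ^ j ≤? m
    ... | no  bʲ≰m = m , 0<m , <⇒≤pred (≰⇒> bʲ≰m) , n∣m , ≤-refl
    ... | yes bʲ≤m
      with m′ , 0<m′ , m′≤ , n∣m′ , sm′≤ ← small-multiple n∣bʲ-1 (rec (fold-< bʲ≤m))
             (fold-positive bʲ≤m) (∣-fold n∣bʲ-1 n∣m)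
      = m′ , 0<m′ , m′≤ , n∣m′ , ≤-trans sm′≤ (s-fold m)

theorem5 : (n b j : ℕ) → .{{_ : NonZero n}} → .{{_ : NonTrivial b}} → .{{_ : NonZero j}} →
    n ∣ b ^ j ∸ 1 →
    Flimsy b n ⇔ (∃[ k ] 1 ≤ k × k ≤ (b ^ j ∸ 1) / n × s b (k * n) < s b n)
theorem5 n b j n∣bʲ-1 = mk⇔ bounded (λ (k , 1≤k , _ , sk<) → k , 1≤k , sk<)
  where
  bounded : Flimsy b n → ∃[ k ] 1 ≤ k × k ≤ (b ^ j ∸ 1) / n × s b (k * n) < s b n
  bounded (k , 1≤k , sk<)
    with small-multiple b j n∣bʲ-1 (<-wellFounded (k * n))
           (*-mono-≤ 1≤k (>-nonZero⁻¹ n)) (divides k refl)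
  -- The new multiplier is the quotient in the divisibility proof; quotient 0 would contradict
  -- positivity of the multiple.
  ... | _ , 0<m , m≤ , divides zero refl , sm≤ with () ← 0<m
  ... | _ , 0<m , m≤ , divides k′@(suc _) refl , sm≤ =
    -- Dividing `k′ * n ≤ b ^ j ∸ 1` by `n` gives the upper bound on `k′`.
    k′ , z<s , subst (_≤ (b ^ j ∸ 1) / n) (m*n/n≡m k′ n) (/-monoˡ-≤ n m≤) , ≤-<-trans sm≤ sk<
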